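{- Let $C_n$ denote the cycle of order $n$ ($n\geq 3$). Then: (a) $pvc(C_3)=0$, $pvc(C_4)=pvc(C_5)=1$, and $pvc(C_n)=2$ for all $n\geq 6$. (b) $pvc_2(C_3)=1$, $pvc_2(C_n)=2$ for all even $n\geq 4$, and $pvc_2(C_n)=3$ for all odd $n\geq 5$.
   Context: All graphs are simple, finite and undirected. Vertex-colorings are arbitrary (adjacent vertices may receive the same color). A path in a vertex-colored graph is a vertex-proper path if any two adjacent internal vertices of the path differ in color (the end-vertices of the path are not internal). A set of internally vertex-disjoint paths is called disjoint. A vertex-colored graph is proper vertex $k$-connected if any two distinct vertices are connected by $k$ (distinct) disjoint vertex-proper paths. For a $k$-connected graph $G$, $pvc_k(G)$ is the smallest number of colors required to make $G$ proper vertex $k$-connected; $pvc(G)=pvc_1(G)$. The value $0$ is allowed: it means that no vertex needs to be colored, where an uncolored path counts as vertex-proper exactly when it has no internal vertices. -}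

module Defs where

open import Data.Empty using (⊥)
open import Data.Fin using (Fin; toℕ)
open import Data.List using (List; []; _∷_; _++_; [_])
open import Data.List.Relation.Binary.Disjoint.Propositional using (Disjoint)
open import Data.List.Relation.Unary.Linked using (Linked)
open import Data.List.Relation.Unary.Unique.Propositional using (Unique)
open import Data.Nat using (ℕ; suc; _≤_; s≤s; _≟_)
open import Data.Nat.Properties using (1+n≢n)
open import Data.Product using (Σ; ∃; _×_; _,_)
open import Data.Sum using (_⊎_; inj₁; inj₂; swap)
open import Level using (0ℓ)
open import Relation.Binary using (Rel; Symmetric; Irreflexive; Decidable)
open import Relation.Binary.PropositionalEquality using (_≡_; _≢_; refl; sym; trans; cong)
open import Relation.Nullary using (_×-dec_; _⊎-dec_)

record Graph : Set₁ where
  field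
    order    : ℕ

  Vertex : Set
  Vertex = Fin order

  field
    _~_      : Rel Vertex 0ℓ
    _~?_     : Decidable _~_
    ~-sym    : Symmetric _~_
    ~-irrefl : Irreflexive _≡_ _~_

open Graph using (Vertex)

-- j is the cyclic successor of i in 0, 1, …, n − 1, 0.
Next : ∀ {n} → Rel (Fin n) 0ℓ
Next {n} i j = suc (toℕ i) ≡ toℕ j ⊎ (suc (toℕ i) ≡ n × toℕ j ≡ 0)

next? : ∀ {n} → Decidable (Next {n})
next? {n} i j = (suc (toℕ i) ≟ toℕ j) ⊎-dec ((suc (toℕ i) ≟ n) ×-dec (toℕ j ≟ 0))

¬next-refl : ∀ {n} → 3 ≤ n → (i : Fin n) → Next i i → ⊥
¬next-refl _   i (inj₁ eq)        = 1+n≢n eq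
¬next-refl 3≤n i (inj₂ (eq , i≡0)) with trans (sym eq) (cong suc i≡0)
¬next-refl (s≤s ()) i (inj₂ _) | refl

C : (n : ℕ) → 3 ≤ n → Graph
C n 3≤n = record
  { order    = n
  ; _~_      = λ i j → Next i j ⊎ Next j i
  ; _~?_     = λ i j → next? i j ⊎-dec next? j i
  ; ~-sym    = swap
  ; ~-irrefl = λ { {i} refl (inj₁ s) → ¬next-refl 3≤n i s
                 ; {i} refl (inj₂ s) → ¬next-refl 3≤n i s }
  }

module _ (G : Graph) where
  open Graph G using (_~_)

  record Path (u v : Vertex G) : Set where
    field
      internal : List (Vertex G)

    vertices : List (Vertex G)
    vertices = u ∷ internal ++ [ v ]

    field
      linked : Linked _~_ vertices
      unique : Unique vertices

  -- With 0 colors no vertex is colored, so a 0-coloring is not a map into Fin 0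
  -- (of which there are none).
  data Coloring : ℕ → Set where
    uncolored : Coloring 0
    colored   : ∀ {c} → (Vertex G → Fin (suc c)) → Coloring (suc c)

module _ {G : Graph} where
  open Path

  VertexProper : ∀ {c u v} → Coloring G c → Path G u v → Set
  VertexProper uncolored   p = internal p ≡ []
  VertexProper (colored f) p = Linked (λ x y → f x ≢ f y) (internal p)

  -- Distinctness is compared on vertex sequences, since two values of type Path
  -- may differ only in their proof fields.  It is not implied by disjointness:
  -- a single edge is internally disjoint from itself.
  ProperVertexConnected : ∀ {c} → ℕ → Coloring G c → Set
  ProperVertexConnected k col =
    ∀ (u v : Vertex G) → u ≢ v →
    Σ (Fin k → Path G u v) λ P →
      (∀ i → VertexProper col (P i)) ×
      (∀ i j → i ≢ j → vertices (P i) ≢ vertices (P j)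
                     × Disjoint (internal (P i)) (internal (P j)))

-- IsPvc k G m says that pvc_k(G) = m.  Connectivity of G is not assumed separately:
-- the first component already provides k disjoint paths between any two vertices.
IsPvc : ℕ → Graph → ℕ → Set
IsPvc k G m =
  (∃ λ (col : Coloring G m) → ProperVertexConnected k col) ×
  (∀ m′ (col : Coloring G m′) → ProperVertexConnected k col → m ≤ m′)

{-# OPTIONS --safe #-}
-- Any two vertices of a cycle are joined by its two arcs, which are internally
-- disjoint.  Coloring vertices by the parity of their number leaves at most the
-- edge {n − 1, 0} monochromatic; for k = 1 one of the arcs has no 0 inside, for
-- k = 2 and n odd the vertex 0 gets a third color.  Conversely, for k = 2 a path
-- from i + 2 to i + 3 other than the edge starts with i + 2, i + 1, i, so
-- consecutive vertices have distinct colors, and two colors force n to be even.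
module Submission where

open import Data.Fin using (Fin; zero; suc; toℕ; opposite)
open import Data.Fin.Properties as Fin using (toℕ-injective; toℕ-fromℕ<; toℕ<n)
open import Data.List using (List; []; _∷_; _++_; [_]; length; applyUpTo)
open import Data.List.Membership.Propositional using (_∉_)
open import Data.List.Membership.Propositional.Properties using (∈-applyUpTo⁻)
open import Data.List.Properties using (applyUpTo-∷ʳ; length-applyUpTo; ∷-injectiveʳ; ∷ʳ-injectiveˡ)
open import Data.List.Relation.Binary.Disjoint.Propositional using (Disjoint)
open import Data.List.Relation.Unary.All as All using (All; []; _∷_)
open import Data.List.Relation.Unary.All.Properties using (¬Any⇒All¬; ++⁻ʳ)
open import Data.List.Relation.Unary.AllPairs using (_∷_)
open import Data.List.Relation.Unary.Any using (here)
open import Data.List.Relation.Unary.Linked as Linked using (Linked; []; [-]; _∷_)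
import Data.List.Relation.Unary.Linked.Properties as Linked
open import Data.List.Relation.Unary.Unique.Propositional using (Unique)
import Data.List.Relation.Unary.Unique.Propositional.Properties as Unique
open import Data.Nat using (ℕ; zero; suc; _+_; _*_; _∸_; _≤_; _<_; z≤n; s≤s; z<s; s≤s⁻¹; pred; _%_; _/_)
open import Data.Nat.Divisibility using (_∣_; _∤_; divides)
open import Data.Nat.DivMod
open import Data.Nat.Properties
open import Data.Product using (∃; ∃₂; _×_; _,_; proj₁; proj₂)
open import Data.Sum using (_⊎_; inj₁; inj₂)
open import Function using (_∘_)
open import Level using (0ℓ)
open import Relation.Binary using (Rel)
open import Relation.Binary.PropositionalEquality hiding ([_])
open import Relation.Nullary using (¬_; yes; no; contradiction)
open import Relation.Nullary.Decidable using (from-yes)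
open import Defs

open Path

-- Lists and finite sets with one or two elements.

module _ {A : Set} where

  Linked-++⁻ˡ : ∀ {R : Rel A 0ℓ} xs {ys} → Linked R (xs ++ ys) → Linked R xs
  Linked-++⁻ˡ []           _        = []
  Linked-++⁻ˡ (_ ∷ [])     _        = [-]
  Linked-++⁻ˡ (_ ∷ _ ∷ xs) (r ∷ rs) = r ∷ Linked-++⁻ˡ (_ ∷ xs) rs

  -- Meant for a coloring in which adjacency forces different colors only between vertices
  -- satisfying `P`; below these are the vertices other than `zero`.
  Linked-map-All : ∀ {P : A → Set} {R S : Rel A 0ℓ} → (∀ {x y} → P x → P y → R x y → S x y) →
                   ∀ {xs} → All P xs → Linked R xs → Linked S xs
  Linked-map-All f _              []       = []
  Linked-map-All f _              [-]      = [-]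
  Linked-map-All f (px ∷ py ∷ ps) (r ∷ rs) = f px py r ∷ Linked-map-All f (py ∷ ps) rs

  length≤1⇒Linked : ∀ {R : Rel A 0ℓ} (xs : List A) → length xs ≤ 1 → Linked R xs
  length≤1⇒Linked []           _        = []
  length≤1⇒Linked (_ ∷ [])     _        = [-]
  length≤1⇒Linked (_ ∷ _ ∷ _) (s≤s ())

  length≤0⇒[] : (xs : List A) → length xs ≤ 0 → xs ≡ []
  length≤0⇒[] [] _ = refl

  Disjoint-self⇒[] : (xs : List A) → Disjoint xs xs → xs ≡ []
  Disjoint-self⇒[] []      _ = refl
  Disjoint-self⇒[] (_ ∷ _) d = contradiction (here refl , here refl) d

Fin1-unique : (x y : Fin 1) → x ≡ y
Fin1-unique zero zero = refl

Fin2-≢-trans : ∀ {x y z : Fin 2} → x ≢ y → y ≢ z → x ≡ z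
Fin2-≢-trans {zero}     {_}        {zero}     _ _ = refl
Fin2-≢-trans {suc zero} {_}        {suc zero} _ _ = refl
Fin2-≢-trans {zero}     {zero}     {suc zero} p _ = contradiction refl p
Fin2-≢-trans {zero}     {suc zero} {suc zero} _ q = contradiction refl q
Fin2-≢-trans {suc zero} {zero}     {zero}     _ q = contradiction refl q
Fin2-≢-trans {suc zero} {suc zero} {zero}     p _ = contradiction refl p

-- Alternating two-valued sequences and parity.

module Alternating (h : ℕ → Fin 2) (h-alt : ∀ k → h (suc k) ≢ h k) where

  double : ∀ q → h (q * 2) ≡ h 0
  double zero    = refl
  double (suc q) = trans (Fin2-≢-trans (h-alt _) (h-alt _)) (double q)

  even : ∀ {n} → 2 ∣ n → h n ≡ h 0
  even (divides q refl) = double q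

  -- An odd `n` is one step past an even number, where `h` has returned to `h 0`; that last step
  -- changes the value.
  odd : ∀ {n} → 2 ∤ n → h n ≢ h 0
  odd {n} 2∤n eq with n % 2 | m%n<n n 2 | m≡m%n+[m/n]*n n 2
  ... | 0           | _              | n≡ = 2∤n (divides (n / 2) n≡)
  ... | 1           | _              | n≡ =
    h-alt _ (trans (sym (cong h n≡)) (trans eq (sym (double (n / 2)))))
  ... | suc (suc _) | s≤s (s≤s ()) | _

parity : ℕ → Fin 2
parity zero    = zero
parity (suc n) = opposite (parity n)

parity-alternating : ∀ n → parity (suc n) ≢ parity n
parity-alternating n with parity n
... | zero     = λ ()
... | suc zero = λ ()

parity-even : ∀ {n} → 2 ∣ n → parity n ≡ zero
parity-even = Alternating.even parity parity-alternating

-- Paths and connectivity in an arbitrary graph.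

module _ {G : Graph} where
  open Graph G using (Vertex; _~_)

  internal-linked : ∀ {u v} (p : Path G u v) → Linked _~_ (internal p)
  internal-linked p = Linked-++⁻ˡ (internal p) (Linked.tail (linked p))

  internal-≡⇒vertices-≡ : ∀ {u v} {p q : Path G u v} →
                          internal p ≡ internal q → vertices p ≡ vertices q
  internal-≡⇒vertices-≡ {u} {v} = cong (λ xs → u ∷ xs ++ [ v ])

  vertices-≡⇒internal-≡ : ∀ {u v} (p q : Path G u v) →
                          vertices p ≡ vertices q → internal p ≡ internal q
  vertices-≡⇒internal-≡ p q eq = ∷ʳ-injectiveˡ (internal p) (internal q) (∷-injectiveʳ eq)

  -- Both arcs of a cycle are built this way, from a formula for the vertex reached after `i` steps;
  -- `l` counts the internal vertices.
  walk : ∀ {u v} (g : ℕ → Vertex) l → g 0 ≡ u → g (suc l) ≡ v →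
         (∀ {i} → i ≤ l → g i ~ g (suc i)) →
         (∀ {i j} → i < j → j ≤ suc l → g i ≢ g j) →
         Path G u v
  walk {u} {v} g l g0≡u gl≡v step distinct = record
    { internal = applyUpTo (g ∘ suc) l
    ; linked   = subst (Linked _~_) (sym eq)
                   (Linked.applyUpTo⁺₁ g (2 + l) (step ∘ s≤s⁻¹ ∘ s≤s⁻¹))
    ; unique   = subst Unique (sym eq)
                   (Unique.applyUpTo⁺₁ g (2 + l) (λ i<j → distinct i<j ∘ s≤s⁻¹))
    }
    where
    eq : u ∷ applyUpTo (g ∘ suc) l ++ [ v ] ≡ applyUpTo g (2 + l)
    eq = cong₂ _∷_ (sym g0≡u)
           (trans (cong (λ w → applyUpTo (g ∘ suc) l ++ [ w ]) (sym gl≡v))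
                  (applyUpTo-∷ʳ (g ∘ suc) l))

  Proper : ∀ {c} → (Vertex → Fin c) → Set
  Proper f = ∀ {x y} → x ~ y → f x ≢ f y

  one-path : ∀ {c} {col : Coloring G c} →
             (∀ {u v} → u ≢ v → ∃ λ (p : Path G u v) → VertexProper col p) →
             ProperVertexConnected 1 col
  one-path path u v u≢v =
    (λ _ → proj₁ (path u≢v)) , (λ _ → proj₂ (path u≢v)) ,
    λ { zero zero 0≢0 → contradiction refl 0≢0 }

  -- Two paths without internal vertices have the same vertex sequence, so of two distinct paths one
  -- has an internal vertex. Every lower bound for two paths starts here.
  nonempty-path : ∀ {c} {col : Coloring G c} → ProperVertexConnected 2 col →
                  ∀ {u v} → u ≢ v → ∃ λ (p : Path G u v) → VertexProper col p × internal p ≢ []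
  nonempty-path conn {u} {v} u≢v with conn u v u≢v
  ... | P , proper , disjoint with internal (P zero) in eq₀ | internal (P (suc zero)) in eq₁
  ...   | _ ∷ _ | _     = P zero , proper zero , λ eq → contradiction (trans (sym eq₀) eq) λ ()
  ...   | []    | _ ∷ _ = P (suc zero) , proper (suc zero) ,
                          λ eq → contradiction (trans (sym eq₁) eq) λ ()
  ...   | []    | []    = contradiction
    (internal-≡⇒vertices-≡ {p = P zero} {P (suc zero)} (trans eq₀ (sym eq₁)))
    (proj₁ (disjoint zero (suc zero) λ ()))

  uncolored-not-2-connected : ∀ {u v : Vertex} → u ≢ v → ¬ ProperVertexConnected {G} 2 uncolored
  uncolored-not-2-connected u≢v conn with nonempty-path conn u≢v
  ... | _ , ≡[] , ≢[] = ≢[] ≡[]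

-- The cyclic successor relation.

module _ {n : ℕ} where

  next-functional : ∀ {x y z : Fin n} → Next x y → Next x z → y ≡ z
  next-functional (inj₁ p)       (inj₁ q)       = toℕ-injective (trans (sym p) q)
  next-functional (inj₂ (_ , p)) (inj₂ (_ , q)) = toℕ-injective (trans p (sym q))
  next-functional {y = y} (inj₁ p) (inj₂ (q , _)) =
    contradiction (trans (sym p) q) (<⇒≢ (toℕ<n y))
  next-functional {z = z} (inj₂ (p , _)) (inj₁ q) =
    contradiction (trans (sym q) p) (<⇒≢ (toℕ<n z))

  next-injective : ∀ {x y z : Fin n} → Next x z → Next y z → x ≡ y
  next-injective (inj₁ p)       (inj₁ q)       = toℕ-injective (suc-injective (trans p (sym q)))
  next-injective (inj₂ (p , _)) (inj₂ (q , _)) = toℕ-injective (suc-injective (trans p (sym q)))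
  next-injective (inj₁ p)       (inj₂ (_ , q)) = contradiction (trans p q) λ ()
  next-injective (inj₂ (_ , p)) (inj₁ q)       = contradiction (trans q p) λ ()

-- The cycle with its vertices numbered modulo `n`.

module Cycle (m : ℕ) (3≤n : 3 ≤ suc m) where

  -- Writing the order as `suc m` makes it visibly nonzero, as `mod` requires, and lets `m` play the
  -- role of -1 modulo `n`.
  n : ℕ
  n = suc m

  G : Graph
  G = C n 3≤n

  open Graph G using (Vertex; _~_)

  -- A periodic numbering by all natural numbers: walking around the cycle becomes adding 1, with no
  -- case distinction at the wrap from `m` to 0.
  rot : ℕ → Vertex
  rot k = k mod n

  toℕ-rot : ∀ k → toℕ (rot k) ≡ k % n
  toℕ-rot k = toℕ-fromℕ< (m%n<n k n)

  rot-cong : ∀ i j → i % n ≡ j % n → rot i ≡ rot j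
  rot-cong i j eq = toℕ-injective (trans (toℕ-rot i) (trans eq (sym (toℕ-rot j))))

  rot-toℕ : (x : Vertex) → rot (toℕ x) ≡ x
  rot-toℕ x = toℕ-injective (trans (toℕ-rot (toℕ x)) (m<n⇒m%n≡m (toℕ<n x)))

  %-+-congˡ : ∀ i j k → i % n ≡ j % n → (i + k) % n ≡ (j + k) % n
  %-+-congˡ i j k eq = begin
    (i + k) % n         ≡⟨ %-distribˡ-+ i k n ⟩
    (i % n + k % n) % n ≡⟨ cong (λ r → (r + k % n) % n) eq ⟩
    (j % n + k % n) % n ≡⟨ %-distribˡ-+ j k n ⟨
    (j + k) % n         ∎
    where open ≡-Reasoning

  -- Adding k * m to k gives k * n, so it undoes the shift by k.
  unshift : ∀ i k → (i + k + k * m) % n ≡ i % n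
  unshift i k = begin
    (i + k + k * m) % n   ≡⟨ cong (_% n) (+-assoc i k (k * m)) ⟩
    (i + (k + k * m)) % n ≡⟨ cong (λ t → (i + t) % n) (*-suc k m) ⟨
    (i + k * n) % n       ≡⟨ [m+kn]%n≡m%n i k n ⟩
    i % n                 ∎
    where open ≡-Reasoning

  -- Adding `k * m` to both sides removes the shift by `k`, and numbers up to `m` are their own
  -- residues.
  rot-injective : ∀ {i j} k → i ≤ m → j ≤ m → rot (i + k) ≡ rot (j + k) → i ≡ j
  rot-injective {i} {j} k i≤m j≤m eq = begin
    i                     ≡⟨ m≤n⇒m%n≡m i≤m ⟨
    i % n                 ≡⟨ unshift i k ⟨
    (i + k + k * m) % n   ≡⟨ %-+-congˡ (i + k) (j + k) (k * m)
                               (trans (sym (toℕ-rot (i + k))) (trans (cong toℕ eq) (toℕ-rot (j + k)))) ⟩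
    (j + k + k * m) % n   ≡⟨ unshift j k ⟩
    j % n                 ≡⟨ m≤n⇒m%n≡m j≤m ⟩
    j                     ∎
    where open ≡-Reasoning

  rot-distance : (u v : Vertex) → ∃ λ d → d ≤ m × rot (d + toℕ u) ≡ v
  rot-distance u v = d , m<1+n⇒m≤n (m%n<n (toℕ v + toℕ u * m) n) ,
                     trans (rot-cong (d + toℕ u) (toℕ v) eq) (rot-toℕ v)
    where
    open ≡-Reasoning
    -- Since `m` acts as -1, this is the residue of `toℕ v` minus `toℕ u`.
    d = (toℕ v + toℕ u * m) % n
    eq : (d + toℕ u) % n ≡ toℕ v % n
    eq = begin
      (d + toℕ u) % n                     ≡⟨ %-+-congˡ d (toℕ v + toℕ u * m) (toℕ u) (m%n%n≡m%n (toℕ v + toℕ u * m) n) ⟩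
      (toℕ v + toℕ u * m + toℕ u) % n     ≡⟨ cong (_% n) (+-assoc (toℕ v) _ _) ⟩
      (toℕ v + (toℕ u * m + toℕ u)) % n   ≡⟨ cong (λ t → (toℕ v + t) % n) (+-comm _ (toℕ u)) ⟩
      (toℕ v + (toℕ u + toℕ u * m)) % n   ≡⟨ cong (_% n) (+-assoc (toℕ v) _ _) ⟨
      (toℕ v + toℕ u + toℕ u * m) % n     ≡⟨ unshift (toℕ v) (toℕ u) ⟩
      toℕ v % n                           ∎

  suc-% : ∀ k → suc k % n ≡ suc (k % n) % n
  suc-% k = begin
    suc k % n         ≡⟨ cong (_% n) (+-comm 1 k) ⟩
    (k + 1) % n       ≡⟨ %-+-congˡ (k % n) k 1 (m%n%n≡m%n k n) ⟨
    (k % n + 1) % n   ≡⟨ cong (_% n) (+-comm (k % n) 1) ⟩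
    suc (k % n) % n   ∎
    where open ≡-Reasoning

  next-rot : ∀ k → Next (rot k) (rot (suc k))
  next-rot k with suc (k % n) ≟ n
  ... | yes last = inj₂ (trans (cong suc (toℕ-rot k)) last , (begin
    toℕ (rot (suc k)) ≡⟨ toℕ-rot (suc k) ⟩
    suc k % n         ≡⟨ suc-% k ⟩
    suc (k % n) % n   ≡⟨ cong (_% n) last ⟩
    n % n             ≡⟨ n%n≡0 n ⟩
    0                 ∎))
    where open ≡-Reasoning
  ... | no ¬last = inj₁ (begin
    suc (toℕ (rot k)) ≡⟨ cong suc (toℕ-rot k) ⟩
    suc (k % n)       ≡⟨ m<n⇒m%n≡m (≤∧≢⇒< (m%n<n k n) ¬last) ⟨
    suc (k % n) % n   ≡⟨ suc-% k ⟨
    suc k % n         ≡⟨ toℕ-rot (suc k) ⟨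
    toℕ (rot (suc k)) ∎)
    where open ≡-Reasoning

  -- Cyclic predecessor and successor are both unique. Centering at `suc k` names the predecessor
  -- without subtraction.
  neighbours : ∀ {x} k → x ~ rot (suc k) → x ≡ rot k ⊎ x ≡ rot (2 + k)
  neighbours k (inj₁ next) = inj₁ (next-injective next (next-rot k))
  neighbours k (inj₂ next) = inj₂ (next-functional next (next-rot (suc k)))

  rot-≢ : ∀ {i j} k → i ≤ m → j ≤ m → i ≢ j → rot (i + k) ≢ rot (j + k)
  rot-≢ k i≤m j≤m i≢j = i≢j ∘ rot-injective k i≤m j≤m

  -- The neighbours of `rot (suc j + k)` have offsets `j` and `2 + j`; the bounds keep these and `i`
  -- within one turn, where different offsets give different vertices.
  rot-nonadjacent : ∀ {i j} k → i ≤ m → 2 + j ≤ m → i ≢ j → i ≢ 2 + j →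
                    ¬ rot (i + k) ~ rot (suc j + k)
  rot-nonadjacent {i} {j} k i≤m j+2≤m i≢j i≢j+2 adj with neighbours (j + k) adj
  ... | inj₁ eq = rot-≢ k i≤m (m+n≤o⇒n≤o 2 j+2≤m) i≢j eq
  ... | inj₂ eq = rot-≢ k i≤m j+2≤m i≢j+2 eq

  -- The two arcs between distinct vertices.

  arcs : ∀ {u v : Vertex} → u ≢ v → ∃₂ λ (p q : Path G u v) →
         Disjoint (internal p) (internal q) ×
         2 + (length (internal p) + length (internal q)) ≡ n
  arcs {u} {v} u≢v with rot-distance u v
  ... | zero  , _     , eq = contradiction (trans (sym (rot-toℕ u)) eq) u≢v
  ... | suc l , l<m , eq = forward , backward , disjoint , lengths
    where
    -- Going forward from `u` to `v` takes `suc l` steps, so going backward takes the remaining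
    -- `n ∸ suc l`, which is `suc l′`.
    l′ = m ∸ suc l
    k  = toℕ u

    m∸l′ : m ∸ suc l′ ≡ l
    m∸l′ = trans (sym (pred[m∸n]≡m∸[1+n] m l′)) (cong pred (m∸[m∸n]≡n l<m))

    l′<m : suc l′ ≤ m
    l′<m = ∸-monoʳ-< {m} {suc l} {0} z<s l<m

    f g : ℕ → Vertex
    f i = rot (i + k)
    -- Going `i` steps back is going `n ∸ i` forward; at `i = 0` this is a full turn.
    g i = rot (suc (m ∸ i) + k)

    forward : Path G u v
    forward = walk f l (rot-toℕ u) eq (λ {i} _ → inj₁ (next-rot (i + k)))
      λ i<j j≤ → rot-≢ k (≤-trans (<⇒≤ i<j) (≤-trans j≤ l<m)) (≤-trans j≤ l<m) (<⇒≢ i<j)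

    backward : Path G u v
    backward = walk g l′ g0 gl step distinct
      where
      g0 : g 0 ≡ u
      g0 = trans (rot-cong (n + k) k (trans (cong (_% n) (+-comm n k)) ([m+n]%n≡m%n k n))) (rot-toℕ u)
      gl : g (suc l′) ≡ v
      gl = trans (cong (λ t → rot (suc t + k)) m∸l′) eq
      step : ∀ {i} → i ≤ l′ → g i ~ g (suc i)
      -- As `suc i` is at most `m`, `m ∸ i` is the successor of `m ∸ suc i`; so each step of `g` is
      -- a step of `rot` traversed backward.
      step {i} i≤ = inj₂ (subst (λ t → Next (g (suc i)) (rot (suc t + k)))
                      (sym (+-∸-assoc 1 (≤-trans (s≤s i≤) l′<m))) (next-rot _))
      distinct : ∀ {i j} → i < j → j ≤ suc l′ → g i ≢ g j
      -- The offset `suc (m ∸ i)` can reach `n`, so its `suc` is moved into the shift `suc k`,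
      -- leaving `m ∸ i`, which is at most `m`.
      distinct {i} {j} i<j j≤ gi≡gj =
        <⇒≢ i<j (∸-cancelˡ-≡ (≤-trans (<⇒≤ i<j) j≤m) j≤m
          (rot-injective (suc k) (m∸n≤m m i) (m∸n≤m m j)
            (subst₂ (λ s t → rot s ≡ rot t) (sym (+-suc _ k)) (sym (+-suc _ k)) gi≡gj)))
        where
        j≤m : j ≤ m
        j≤m = ≤-trans j≤ l′<m

    disjoint : Disjoint (internal forward) (internal backward)
    disjoint (x∈p , x∈q) =
      let i , i<l  , x≡fi = ∈-applyUpTo⁻ (f ∘ suc) x∈p
          j , j<l′ , x≡gj = ∈-applyUpTo⁻ (g ∘ suc) x∈q
      in separated i<l j<l′ (trans (sym x≡fi) x≡gj)
      where
      open ≤-Reasoning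
      -- Measured forward from `u`, internal vertices of `forward` have offsets at most `l`, those
      -- of `backward` offsets from `2 + l` to `m`.
      separated : ∀ {i j} → i < l → j < l′ → f (suc i) ≢ g (suc j)
      separated {i} {j} i<l j<l′ fi≡gj = <⇒≱ i<l (begin
        l            ≡⟨ m∸l′ ⟨
        m ∸ suc l′   ≤⟨ ∸-monoʳ-≤ m (s≤s (<⇒≤ j<l′)) ⟩
        m ∸ suc j    ≡⟨ suc-injective (rot-injective k (≤-trans (s≤s (<⇒≤ i<l)) l<m)
                          (∸-monoʳ-< {m} {suc j} {0} z<s (≤-trans (s≤s (<⇒≤ j<l′)) l′<m)) fi≡gj) ⟨
        i            ∎)

    lengths : 2 + (length (internal forward) + length (internal backward)) ≡ n
    lengths = cong suc (trans
      (cong₂ (λ s t → suc (s + t)) (length-applyUpTo (f ∘ suc) l) (length-applyUpTo (g ∘ suc) l′))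
      (m+[n∸m]≡n l<m))

  -- Both arcs meet the length bound because they share `n ∸ 2` internal vertices between them. In
  -- the triangle it leaves at most one internal vertex per arc.
  two-paths : ∀ {c} {col : Coloring G c} →
              (∀ {u v} (p : Path G u v) → 2 + length (internal p) ≤ n → VertexProper col p) →
              ProperVertexConnected 2 col
  two-paths proper u v u≢v with arcs u≢v
  ... | p , q , disjoint , lengths =
    P , (λ { zero       → proper p (≤-trans (+-monoʳ-≤ 2 (m≤m+n _ _)) (≤-reflexive lengths))
           ; (suc zero) → proper q (≤-trans (+-monoʳ-≤ 2 (m≤n+m _ _)) (≤-reflexive lengths)) })
      , (λ { zero       zero       i≢i → contradiction refl i≢i
           ; (suc zero) (suc zero) i≢i → contradiction refl i≢i
           ; zero       (suc zero) _   → distinct , disjoint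
           ; (suc zero) zero       _   → distinct ∘ sym , λ (x∈q , x∈p) → disjoint (x∈p , x∈q) })
    where
    P : Fin 2 → Path G u v
    P zero       = p
    P (suc zero) = q

    distinct : vertices p ≢ vertices q
    -- If the arcs coincided, disjointness would leave both without internal vertices, so `n` would
    -- be 2.
    distinct eq with vertices-≡⇒internal-≡ p q eq
    ... | p≡q with Disjoint-self⇒[] _ (subst (Disjoint (internal p)) (sym p≡q) disjoint)
    ...   | p≡[] = <⇒≢ 3≤n (trans
      (cong₂ (λ xs ys → 2 + (length xs + length ys)) (sym p≡[]) (trans (sym p≡[]) p≡q)) lengths)

  -- If both arcs had at least `suc l` internal vertices, the cycle would have at least
  -- `4 + (l + l)` vertices.
  short-arc : ∀ l → n ≤ 3 + (l + l) → ∀ {u v} → u ≢ v →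
              ∃ λ (p : Path G u v) → length (internal p) ≤ l
  short-arc l n≤ u≢v with arcs u≢v
  ... | p , q , _ , lengths with length (internal p) ≤? l | length (internal q) ≤? l
  ...   | yes p≤l | _       = p , p≤l
  ...   | no _    | yes q≤l = q , q≤l
  ...   | no p≰l  | no q≰l  = contradiction
    (≤-trans (+-monoʳ-≤ 2 (≤-trans (≤-reflexive (sym (+-suc (suc l) l)))
                                  (+-mono-≤ (≰⇒> p≰l) (≰⇒> q≰l))))
             (≤-trans (≤-reflexive lengths) n≤)) 1+n≰n

  -- Colorings that give the upper bounds.

  parityColor : Vertex → Fin 2
  parityColor = parity ∘ toℕ

  -- Excluding `zero` as the target rules out the wrap, the only step at which the number does not
  -- grow by 1.
  parity-next : ∀ {x y : Vertex} → zero ≢ y → Next x y → parityColor y ≢ parityColor x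
  parity-next {x} _  (inj₁ eq) par = parity-alternating (toℕ x) (trans (cong parity eq) par)
  parity-next 0≢y    (inj₂ (_ , eq)) = contradiction (toℕ-injective (sym eq)) 0≢y

  parity-adjacent : ∀ {x y : Vertex} → zero ≢ x → zero ≢ y → x ~ y → parityColor x ≢ parityColor y
  parity-adjacent 0≢x 0≢y (inj₁ next) = parity-next 0≢y next ∘ sym
  parity-adjacent 0≢x 0≢y (inj₂ next) = parity-next 0≢x next

  -- For even `n` the wrap changes parity too, because 0 has the parity of `n`.
  parity-next-even : 2 ∣ n → ∀ {x y : Vertex} → Next x y → parityColor y ≢ parityColor x
  parity-next-even 2∣n {x} (inj₁ eq) par = parity-alternating (toℕ x) (trans (cong parity eq) par)
  parity-next-even 2∣n {x} (inj₂ (last , eq)) par = parity-alternating (toℕ x)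
    (trans (trans (cong parity last) (parity-even 2∣n)) (trans (sym (cong parity eq)) par))

  parity-proper : 2 ∣ n → Proper {G} parityColor
  parity-proper 2∣n (inj₁ next) = parity-next-even 2∣n next ∘ sym
  parity-proper 2∣n (inj₂ next) = parity-next-even 2∣n next

  threeColor : Vertex → Fin 3
  threeColor zero      = zero
  threeColor x@(suc _) = suc (parityColor x)

  threeColor-proper : Proper {G} threeColor
  threeColor-proper {zero}  {zero}  adj = contradiction adj (Graph.~-irrefl G refl)
  threeColor-proper {zero}  {suc _} _   = λ ()
  threeColor-proper {suc _} {zero}  _   = λ ()
  threeColor-proper {suc _} {suc _} adj = parity-adjacent (λ ()) (λ ()) adj ∘ Fin.suc-injective

  proper-2-connected : ∀ {c} {f : Vertex → Fin (suc c)} → Proper {G} f →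
                       ProperVertexConnected {G} 2 (colored f)
  proper-2-connected f-proper = two-paths λ p _ → Linked.map f-proper (internal-linked p)

  avoiding-0-proper : ∀ {u v} (p : Path G u v) → zero ∉ internal p →
                      VertexProper (colored parityColor) p
  avoiding-0-proper p 0∉p = Linked-map-All parity-adjacent (¬Any⇒All¬ _ 0∉p) (internal-linked p)

  parity-1-connected : ProperVertexConnected {G} 1 (colored parityColor)
  parity-1-connected = one-path path
    where
    open import Data.List.Membership.DecPropositional (Fin._≟_ {n}) using (_∈?_)
    path : ∀ {u v} → u ≢ v → ∃ λ (p : Path G u v) → VertexProper (colored parityColor) p
    path u≢v with arcs u≢v
    ... | p , q , disjoint , _ with zero ∈? internal p
    ...   | no  0∉p = p , avoiding-0-proper p 0∉p
    ...   | yes 0∈p = q , avoiding-0-proper q λ 0∈q → disjoint (0∈p , 0∈q)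

  -- Obstructions that give the lower bounds.

  uncolored-not-1-connected : 3 ≤ m → ¬ ProperVertexConnected {G} 1 uncolored
  uncolored-not-1-connected 3≤m conn
    -- From four vertices on, `rot 0` and `rot 2` are not adjacent, so every path between them has
    -- an internal vertex.
    with conn (rot 0) (rot 2) (rot-≢ 0 z≤n (≤-trans (from-yes (2 ≤? 3)) 3≤m) λ ())
  ... | P , empty , _ = rot-nonadjacent 0 z≤n 3≤m (λ ()) (λ ())
    (Linked.head (subst (λ xs → Linked _~_ (rot 0 ∷ xs ++ [ rot 2 ])) (empty zero) (linked (P zero))))

  -- With one color a vertex-proper path has at most one internal vertex, while `rot 0` and `rot 3`
  -- are at distance three once `n` is at least 6.
  monochromatic-not-1-connected : 5 ≤ m → (f : Vertex → Fin 1) →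
                                  ¬ ProperVertexConnected {G} 1 (colored f)
  monochromatic-not-1-connected 5≤m f conn
    with conn (rot 0) (rot 3) (rot-≢ 0 z≤n (≤-trans (from-yes (3 ≤? 5)) 5≤m) λ ())
  ... | P , proper , _ with internal (P zero) | linked (P zero) | proper zero
  ...   | []        | adj ∷ _      | _      =
    rot-nonadjacent 0 z≤n (≤-trans (from-yes (4 ≤? 5)) 5≤m) (λ ()) (λ ()) adj
  ...   | _ ∷ _ ∷ _ | _            | f≢ ∷ _ = f≢ (Fin1-unique _ _)
  -- A single internal vertex would be `rot 2` or `rot 4`, neither of them adjacent to `rot 0`.
  ...   | _ ∷ []    | adj ∷ adj′ ∷ _ | _ with neighbours 2 adj′
  ...     | inj₁ refl =
    rot-nonadjacent 0 z≤n (≤-trans (from-yes (3 ≤? 5)) 5≤m) (λ ()) (λ ()) adj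
  ...     | inj₂ refl = rot-nonadjacent 0 z≤n 5≤m (λ ()) (λ ()) adj

  -- The endpoints `rot (2 + k)` and `rot (3 + k)` are chosen so that `rot (suc k)` and `rot k`
  -- become the first two internal vertices of the path around; with at least four vertices, `rot k`
  -- is not yet its end.
  consecutive-colors-differ : 3 ≤ m → ∀ {c} {f : Vertex → Fin (suc c)} →
                              ProperVertexConnected {G} 2 (colored f) →
                              ∀ k → f (rot (suc k)) ≢ f (rot k)
  consecutive-colors-differ 3≤m {f = f} conn k
    with nonempty-path conn (rot-≢ {2} {3} k (≤-trans (from-yes (2 ≤? 3)) 3≤m) 3≤m λ ())
  ... | p , proper , nonempty with internal p | linked p | unique p | proper
  ...   | []         | _       | _                | _ = contradiction refl nonempty
  ...   | x ∷ xs     | adj ∷ l | ux ∷ (xu ∷ _) | pr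
    with neighbours (suc k) (Graph.~-sym G {rot (2 + k)} {x} adj)
  -- An internal vertex cannot be the endpoint `rot (3 + k)`, so the path leaves the other way.
  ...     | inj₂ refl = contradiction refl (All.head (++⁻ʳ xs xu))
  ...     | inj₁ refl with xs | l | ux | pr
  -- Stopping here would make `rot (1 + k)` and `rot (3 + k)` adjacent, which happens only in the
  -- triangle.
  ...       | []    | adj′ ∷ _ | _            | _ =
    contradiction adj′ (rot-nonadjacent k 3≤m (≤-trans (from-yes (2 ≤? 3)) 3≤m) (λ ()) (λ ())
      ∘ Graph.~-sym G {rot (1 + k)} {rot (3 + k)})
  ...       | y ∷ _ | adj′ ∷ _ | _ ∷ u≢y ∷ _ | fx≢fy ∷ _
    with neighbours k (Graph.~-sym G {rot (1 + k)} {y} adj′)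
  ...         | inj₁ refl = fx≢fy
  ...         | inj₂ refl = contradiction refl u≢y

  monochromatic-not-2-connected : 3 ≤ m → (f : Vertex → Fin 1) →
                                  ¬ ProperVertexConnected {G} 2 (colored f)
  monochromatic-not-2-connected 3≤m f conn =
    consecutive-colors-differ 3≤m conn 0 (Fin1-unique _ _)

  -- The colors alternate along `f ∘ rot`, so an odd number `n` of steps changes the color, although
  -- `rot n` is `rot 0`.
  two-colors-not-2-connected : 3 ≤ m → 2 ∤ n → (f : Vertex → Fin 2) →
                               ¬ ProperVertexConnected {G} 2 (colored f)
  two-colors-not-2-connected 3≤m 2∤n f conn =
    Alternating.odd (f ∘ rot) (consecutive-colors-differ 3≤m conn) 2∤n
      (cong f (rot-cong n 0 (n%n≡0 n)))

  0≢1 : rot 0 ≢ rot 1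
  0≢1 = rot-≢ 0 z≤n (≤-trans (from-yes (1 ≤? 2)) (s≤s⁻¹ 3≤n)) λ ()

  -- The exact values.

  pvc≡0 : n ≤ 3 → IsPvc 1 G 0
  pvc≡0 n≤3 = (uncolored , one-path λ u≢v →
      let p , p≤0 = short-arc 0 n≤3 u≢v in p , length≤0⇒[] (internal p) p≤0)
    , λ _ _ _ → z≤n

  -- With at most five vertices the shorter arc has at most one internal vertex, so it has no two
  -- adjacent internal vertices to tell apart.
  pvc≡1 : 4 ≤ n → n ≤ 5 → IsPvc 1 G 1
  pvc≡1 4≤n n≤5 = (colored (λ _ → zero) , one-path λ u≢v →
      let p , p≤1 = short-arc 1 n≤5 u≢v in p , length≤1⇒Linked (internal p) p≤1)
    , λ { _ uncolored   conn → contradiction conn (uncolored-not-1-connected (s≤s⁻¹ 4≤n))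
        ; _ (colored _) _    → s≤s z≤n }

  pvc≡2 : 6 ≤ n → IsPvc 1 G 2
  pvc≡2 6≤n = (colored parityColor , parity-1-connected)
    , λ { _ uncolored         conn → contradiction conn
            (uncolored-not-1-connected (≤-trans (from-yes (3 ≤? 5)) (s≤s⁻¹ 6≤n)))
        -- The implicit argument is one less than the number of colors, so this is the case of a
        -- single color.
        ; _ (colored {0} f)     conn → contradiction conn (monochromatic-not-1-connected (s≤s⁻¹ 6≤n) f)
        ; _ (colored {suc _} _) _    → s≤s (s≤s z≤n) }

  pvc₂≡1 : n ≤ 3 → IsPvc 2 G 1
  pvc₂≡1 n≤3 = (colored (λ _ → zero) , two-paths λ p p≤ →
      length≤1⇒Linked (internal p) (s≤s⁻¹ (s≤s⁻¹ (≤-trans p≤ n≤3))))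
    , λ { _ uncolored   conn → contradiction conn (uncolored-not-2-connected 0≢1)
        ; _ (colored _) _    → s≤s z≤n }

  pvc₂≡2 : 4 ≤ n → 2 ∣ n → IsPvc 2 G 2
  pvc₂≡2 4≤n 2∣n = (colored parityColor , proper-2-connected (parity-proper 2∣n))
    , λ { _ uncolored         conn → contradiction conn (uncolored-not-2-connected 0≢1)
        ; _ (colored {0} f)     conn → contradiction conn (monochromatic-not-2-connected (s≤s⁻¹ 4≤n) f)
        ; _ (colored {suc _} _) _    → s≤s (s≤s z≤n) }

  pvc₂≡3 : 4 ≤ n → 2 ∤ n → IsPvc 2 G 3
  pvc₂≡3 4≤n 2∤n = (colored threeColor , proper-2-connected threeColor-proper)
    , λ { _ uncolored         conn → contradiction conn (uncolored-not-2-connected 0≢1)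
        ; _ (colored {0} f)     conn → contradiction conn (monochromatic-not-2-connected (s≤s⁻¹ 4≤n) f)
        ; _ (colored {1} f)     conn → contradiction conn (two-colors-not-2-connected (s≤s⁻¹ 4≤n) 2∤n f)
        ; _ (colored {suc (suc _)} _) _ → s≤s (s≤s (s≤s z≤n)) }

theorem2 : ( IsPvc 1 (C 3 (m≤m+n 3 0)) 0
    × IsPvc 1 (C 4 (m≤m+n 3 1)) 1
    × IsPvc 1 (C 5 (m≤m+n 3 2)) 1
    × (∀ n (3≤n : 3 ≤ n) → 6 ≤ n → IsPvc 1 (C n 3≤n) 2) )
    ×
    ( IsPvc 2 (C 3 (m≤m+n 3 0)) 1
    × (∀ n (3≤n : 3 ≤ n) → 4 ≤ n → 2 ∣ n → IsPvc 2 (C n 3≤n) 2)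
    × (∀ n (3≤n : 3 ≤ n) → 5 ≤ n → 2 ∤ n → IsPvc 2 (C n 3≤n) 3) )
theorem2 =
  ( Cycle.pvc≡0 2 (m≤m+n 3 0) ≤-refl
  , Cycle.pvc≡1 3 (m≤m+n 3 1) ≤-refl (n≤1+n 4)
  , Cycle.pvc≡1 4 (m≤m+n 3 2) (n≤1+n 4) ≤-refl
  , (λ { (suc m) 3≤n → Cycle.pvc≡2 m 3≤n }) ) ,
  ( Cycle.pvc₂≡1 2 (m≤m+n 3 0) ≤-refl
  , (λ { (suc m) 3≤n → Cycle.pvc₂≡2 m 3≤n })
  , (λ { (suc m) 3≤n 5≤n → Cycle.pvc₂≡3 m 3≤n (<⇒≤ 5≤n) }) )
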